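{- Let $(x_n)_{n\ge 0}$ be the sequence of positive integers defined by $x_0=x_1=1$ and $x_{n+2}x_n=x_{n+1}^2(x_n+1)$ for $n\ge 0$. Then $$\left[1;1,x_1,1,x_2,1,x_3,1,x_4,\ldots,1,x_k,\ldots\right]=\sum_{n=1}^{\infty}\frac{1}{x_n}.$$
   Context: $[c_0;c_1,c_2,\ldots]$ denotes the regular continued fraction $c_0+\cfrac{1}{c_1+\cfrac{1}{c_2+\cdots}}$. Here $c_0=1$ and, for $k\ge 1$, $c_{2k-1}=1$ and $c_{2k}=x_k$. -}

module Defs where

open import Data.Nat.Base as ℕ using (ℕ; zero; suc; z≤n; s≤s)
import Data.Nat.Properties as ℕ
open import Data.Nat.Tactic.RingSolver using (solve)
open import Data.Integer.Base as ℤ using (ℤ; +_)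
open import Data.List.Base using (List; []; _∷_)
open import Data.Product using (∃; _×_; _,_; proj₁; proj₂)
open import Data.Rational.Base
open import Data.Rational.Properties
open import Data.Rational.Solver using (module +-*-Solver)
open import Data.Sum.Base using (inj₁; inj₂)
open import Relation.Binary.PropositionalEquality

IsCauchy : (ℕ → ℚ) → Set
IsCauchy u = ∀ ε → 0ℚ < ε → ∃ λ N → ∀ m n → N ℕ.≤ m → N ℕ.≤ n → ∣ u m - u n ∣ < ε

-- Cauchy reals; no quotient is taken, so a real has many representatives.
record ℝ : Set where
  constructor mkℝ
  field
    seq      : ℕ → ℚ
    isCauchy : IsCauchy seq

open ℝ public

private
  ∣p-p∣≡0 : ∀ p → ∣ p - p ∣ ≡ 0ℚ
  ∣p-p∣≡0 p = cong ∣_∣ (+-inverseʳ p)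

  ½ε+½ε : ∀ ε → ½ * ε + ½ * ε ≡ ε
  ½ε+½ε ε = trans (sym (*-distribʳ-+ ε ½ ½)) (*-identityˡ ε)

  0<½ε : ∀ {ε} → 0ℚ < ε → 0ℚ < ½ * ε
  0<½ε {ε} 0<ε = positive⁻¹ (½ * ε) {{pos*pos⇒pos ½ ε {{positive 0<ε}}}}

  regroup : ∀ a b c d → (a - b) - (c - d) ≡ (a - c) - (b - d)
  regroup = +-*-Solver.solve 4
    (λ a b c d → ((a :- b) :- (c :- d)) := ((a :- c) :- (b :- d))) refl
    where open +-*-Solver

  cancel : ∀ p q → p ≡ (p - q) + q
  cancel = +-*-Solver.solve 2 (λ p q → p := ((p :- q) :+ q)) refl
    where open +-*-Solver

  flip-- : ∀ p q → - (p - q) ≡ q - p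
  flip-- = +-*-Solver.solve 2 (λ p q → (:- (p :- q)) := (q :- p)) refl
    where open +-*-Solver

  ∣p∣-∣q∣≤∣p-q∣ : ∀ p q → ∣ p ∣ - ∣ q ∣ ≤ ∣ p - q ∣
  ∣p∣-∣q∣≤∣p-q∣ p q = begin
    ∣ p ∣ - ∣ q ∣                  ≡⟨ cong (λ h → ∣ h ∣ - ∣ q ∣) (cancel p q) ⟩
    ∣ (p - q) + q ∣ - ∣ q ∣        ≤⟨ +-monoˡ-≤ (- ∣ q ∣) (∣p+q∣≤∣p∣+∣q∣ (p - q) q) ⟩
    (∣ p - q ∣ + ∣ q ∣) - ∣ q ∣    ≡⟨ +-assoc ∣ p - q ∣ ∣ q ∣ (- ∣ q ∣) ⟩
    ∣ p - q ∣ + (∣ q ∣ - ∣ q ∣)    ≡⟨ cong (λ h → ∣ p - q ∣ + h) (+-inverseʳ ∣ q ∣) ⟩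
    ∣ p - q ∣ + 0ℚ                 ≡⟨ +-identityʳ ∣ p - q ∣ ⟩
    ∣ p - q ∣                      ∎
    where open ≤-Reasoning

  ∣∣p∣-∣q∣∣≤∣p-q∣ : ∀ p q → ∣ ∣ p ∣ - ∣ q ∣ ∣ ≤ ∣ p - q ∣
  ∣∣p∣-∣q∣∣≤∣p-q∣ p q with ∣p∣≡p∨∣p∣≡-p (∣ p ∣ - ∣ q ∣)
  ... | inj₁ eq = ≤-trans (≤-reflexive eq) (∣p∣-∣q∣≤∣p-q∣ p q)
  ... | inj₂ eq = begin
    ∣ ∣ p ∣ - ∣ q ∣ ∣  ≡⟨ eq ⟩
    - (∣ p ∣ - ∣ q ∣)  ≡⟨ flip-- ∣ p ∣ ∣ q ∣ ⟩
    ∣ q ∣ - ∣ p ∣      ≤⟨ ∣p∣-∣q∣≤∣p-q∣ q p ⟩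
    ∣ q - p ∣          ≡⟨ cong ∣_∣ (flip-- p q) ⟨
    ∣ - (p - q) ∣      ≡⟨ ∣-p∣≡∣p∣ (p - q) ⟩
    ∣ p - q ∣          ∎
    where open ≤-Reasoning

fromℚ : ℚ → ℝ
fromℚ q = mkℝ (λ _ → q) λ ε 0<ε →
  0 , λ _ _ _ _ → subst (_< ε) (sym (∣p-p∣≡0 q)) 0<ε

infixl 6 _-ℝ_
_-ℝ_ : ℝ → ℝ → ℝ
α -ℝ β = mkℝ (λ n → seq α n - seq β n) λ ε 0<ε →
  let M , hα = isCauchy α (½ * ε) (0<½ε 0<ε)
      N , hβ = isCauchy β (½ * ε) (0<½ε 0<ε)
      open ≤-Reasoning
  in M ℕ.⊔ N , λ m n m≥ n≥ →
  let a = seq α m - seq α n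
      b = seq β m - seq β n
  in begin-strict
  ∣ (seq α m - seq β m) - (seq α n - seq β n) ∣
    ≡⟨ cong ∣_∣ (regroup (seq α m) (seq β m) (seq α n) (seq β n)) ⟩
  ∣ a - b ∣
    ≤⟨ ∣p-q∣≤∣p∣+∣q∣ a b ⟩
  ∣ a ∣ + ∣ b ∣
    <⟨ +-mono-< (hα m n (ℕ.m⊔n≤o⇒m≤o M N m≥) (ℕ.m⊔n≤o⇒m≤o M N n≥))
                (hβ m n (ℕ.m⊔n≤o⇒n≤o M N m≥) (ℕ.m⊔n≤o⇒n≤o M N n≥)) ⟩
  ½ * ε + ½ * ε
    ≡⟨ ½ε+½ε ε ⟩
  ε ∎

∣_∣ℝ : ℝ → ℝ
∣ α ∣ℝ = mkℝ (λ n → ∣ seq α n ∣) λ ε 0<ε →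
  let N , h = isCauchy α ε 0<ε
  in N , λ m n m≥ n≥ → ≤-<-trans (∣∣p∣-∣q∣∣≤∣p-q∣ (seq α m) (seq α n)) (h m n m≥ n≥)

-- The gap δ must be uniform: a pointwise eventual _<_ of the representing
-- sequences would not respect equality of reals.
infix 4 _<ℝ_
_<ℝ_ : ℝ → ℝ → Set
α <ℝ β = ∃ λ δ → 0ℚ < δ × ∃ λ N → ∀ n → N ℕ.≤ n → seq α n + δ ≤ seq β n

-- Rational ε suffice, since the rationals are cofinal among the positive
-- reals towards 0.
infix 4 _⟶_
_⟶_ : (ℕ → ℚ) → ℝ → Set
u ⟶ α = ∀ ε → 0ℚ < ε → ∃ λ N → ∀ n → N ℕ.≤ n → ∣ fromℚ (u n) -ℝ α ∣ℝ <ℝ fromℚ ε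

partialSum : (ℕ → ℚ) → ℕ → ℚ
partialSum a zero    = 0ℚ
partialSum a (suc n) = partialSum a n + a n

HasSum : (ℕ → ℚ) → ℝ → Set
HasSum a α = partialSum a ⟶ α

-- convergent c c≢0 n = [c 0; c 1, …, c n].  All partial quotients are
-- positive, the first one included, as needed for c 0 = 1.
mutual
  convergent : (c : ℕ → ℕ) → (∀ n → ℕ.NonZero (c n)) → ℕ → ℚ
  convergent c c≢0 zero    = + c 0 / 1
  convergent c c≢0 (suc n) = + c 0 / 1 + (1/ tail) {{pos⇒nonZero tail {{tail-pos}}}}
    where
    tail     = convergent     (λ k → c (suc k)) (λ k → c≢0 (suc k)) n
    tail-pos = convergent-pos (λ k → c (suc k)) (λ k → c≢0 (suc k)) n

  convergent-pos : ∀ c c≢0 n → Positive (convergent c c≢0 n)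
  convergent-pos c c≢0 zero    = normalize-pos (c 0) 1 {{_}} {{c≢0 0}}
  convergent-pos c c≢0 (suc n) =
    pos+pos⇒pos (+ c 0 / 1) {{normalize-pos (c 0) 1 {{_}} {{c≢0 0}}}}
      ((1/ tail) {{pos⇒nonZero tail {{tail-pos}}}}) {{1/pos⇒pos tail {{tail-pos}}}}
    where
    tail     = convergent     (λ k → c (suc k)) (λ k → c≢0 (suc k)) n
    tail-pos = convergent-pos (λ k → c (suc k)) (λ k → c≢0 (suc k)) n

HasCFValue : (c : ℕ → ℕ) → (∀ n → ℕ.NonZero (c n)) → ℝ → Set
HasCFValue c c≢0 α = convergent c c≢0 ⟶ α

-- 1; 1, x 1, 1, x 2, 1, x 3, …
quotients : (ℕ → ℕ) → ℕ → ℕ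
quotients x 0                   = 1
quotients x 1                   = 1
quotients x 2                   = x 1
quotients x (suc (suc (suc n))) = quotients (λ k → x (suc k)) (suc n)

quotients-odd : ∀ x k → 1 ℕ.≤ k → quotients x (2 ℕ.* k ℕ.∸ 1) ≡ 1
quotients-odd x (suc k) _ =
  trans (cong (quotients x) (ℕ.+-suc k (k ℕ.+ 0))) (go x k)
  where
  go : ∀ x k → quotients x (suc (2 ℕ.* k)) ≡ 1
  go x zero    = refl
  go x (suc k) =
    trans (cong (λ m → quotients x (suc m)) (ℕ.*-suc 2 k)) (go (λ j → x (suc j)) k)

quotients-even : ∀ x k → 1 ℕ.≤ k → quotients x (2 ℕ.* k) ≡ x k
quotients-even x (suc k) _ = trans (cong (quotients x) (ℕ.*-suc 2 k)) (go x k)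
  where
  go : ∀ x k → quotients x (suc (suc (2 ℕ.* k))) ≡ x (suc k)
  go x zero    = refl
  go x (suc k) =
    trans (cong (λ m → quotients x (suc (suc m))) (ℕ.*-suc 2 k))
          (go (λ j → x (suc j)) k)

quotients-nonZero : ∀ x → (∀ n → ℕ.NonZero (x n)) → ∀ n → ℕ.NonZero (quotients x n)
quotients-nonZero x x≢0 0                   = _
quotients-nonZero x x≢0 1                   = _
quotients-nonZero x x≢0 2                   = x≢0 1
quotients-nonZero x x≢0 (suc (suc (suc n))) =
  quotients-nonZero (λ k → x (suc k)) (λ k → x≢0 (suc k)) (suc n)

record IsSequenceX (x : ℕ → ℕ) : Set where
  field
    x≢0        : ∀ n → ℕ.NonZero (x n)
    x₀≡1       : x 0 ≡ 1
    x₁≡1       : x 1 ≡ 1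
    recurrence : ∀ n → x (n ℕ.+ 2) ℕ.* x n ≡ x (n ℕ.+ 1) ℕ.^ 2 ℕ.* (x n ℕ.+ 1)

-- The recurrence does define a sequence of positive integers: the ratios
-- z n = x (n + 1) / x n are integers with z (n + 1) = z n * (x n + 1).
sequenceX-exists : ∃ IsSequenceX
sequenceX-exists = x , record
  { x≢0        = λ n → proj₁ (nz n)
  ; x₀≡1       = refl
  ; x₁≡1       = refl
  ; recurrence = rec
  }
  where
  xz : ℕ → ℕ × ℕ
  xz zero    = 1 , 1
  xz (suc n) = proj₁ (xz n) ℕ.* proj₂ (xz n) , proj₂ (xz n) ℕ.* suc (proj₁ (xz n))

  x : ℕ → ℕ
  x n = proj₁ (xz n)

  nz : ∀ n → ℕ.NonZero (proj₁ (xz n)) × ℕ.NonZero (proj₂ (xz n))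
  nz zero    = _ , _
  nz (suc n) =
    ℕ.m*n≢0 _ _ {{proj₁ (nz n)}} {{proj₂ (nz n)}} , ℕ.m*n≢0 _ _ {{proj₂ (nz n)}}

  identity : ∀ a z → (a ℕ.* z) ℕ.* (z ℕ.* suc a) ℕ.* a ≡ (a ℕ.* z) ℕ.* ((a ℕ.* z) ℕ.* 1) ℕ.* (a ℕ.+ 1)
  identity a z = solve (a ∷ z ∷ [])

  rec : ∀ n → x (n ℕ.+ 2) ℕ.* x n ≡ x (n ℕ.+ 1) ℕ.^ 2 ℕ.* (x n ℕ.+ 1)
  rec n rewrite ℕ.+-comm n 2 | ℕ.+-comm n 1 = identity (x n) (proj₂ (xz n))

{-# OPTIONS --safe #-}
-- Let p n / q n be the convergents, S k the partial sums and x the sequence.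
-- A joint induction gives
--   q (2k) = x (k+1),  x (k+2) = x (k+1) (q (2k+1) + 1),
--   p (2k+1) x (k+1) = p (2k) q (2k+1) + 1,
-- whence the even convergents are the partial sums, p (2k) / q (2k) = S (k+1),
-- and p (2k+1) / q (2k+1) = S (k+1) + 1 / (x (k+1) q (2k+1)).  As x at least
-- doubles from index 1 on, the intervals [S (k+1), S (k+1) + 1 / x (k+1)] are
-- nested and shrinking, and they trap both sequences.
module Submission where

open import Defs
open import Data.Nat.Base as ℕ using (ℕ; zero; suc)
import Data.Nat.Properties as ℕ
open import Data.Nat.Tactic.RingSolver using (solve)
import Data.Integer.Base as ℤ
open import Data.Integer.Base using (+_)
import Data.Integer.Properties as ℤ
open import Data.List.Base using ([]; _∷_)
open import Data.Product using (∃; _×_; _,_)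
open import Data.Rational.Base
open import Data.Rational.Properties
open import Data.Rational.Solver using (module +-*-Solver)
import Data.Rational.Unnormalised.Base as ℚᵘ
import Data.Rational.Unnormalised.Properties as ℚᵘ
open import Data.Sum.Base using (inj₁; inj₂)
open import Function.Base using (_∘_)
open import Relation.Binary.PropositionalEquality

-- Rational arithmetic

ι : ℕ → ℚ
ι n = + n / 1

-- Normalised fractions hide their numerators behind a gcd. In the unnormalised rationals the
-- identity is one between integers, and `toℚᵘ` is injective.
ι-+ : ∀ m n → ι (m ℕ.+ n) ≡ ι m + ι n
ι-+ m n = toℚᵘ-injective (begin-equality
  toℚᵘ (ι (m ℕ.+ n))                   ≃⟨ toℚᵘ-fromℚᵘ (ℚᵘ.mkℚᵘ (+ (m ℕ.+ n)) 0) ⟩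
  ℚᵘ.mkℚᵘ (+ (m ℕ.+ n)) 0              ≃⟨ ℚᵘ.*≡* (cong (λ i → i ℤ.* + 1)
                                            (sym (cong₂ ℤ._+_ (ℤ.*-identityʳ (+ m)) (ℤ.*-identityʳ (+ n))))) ⟩
  ℚᵘ.mkℚᵘ (+ m) 0 ℚᵘ.+ ℚᵘ.mkℚᵘ (+ n) 0 ≃⟨ ℚᵘ.+-cong (toℚᵘ-fromℚᵘ (ℚᵘ.mkℚᵘ (+ m) 0))
                                                     (toℚᵘ-fromℚᵘ (ℚᵘ.mkℚᵘ (+ n) 0)) ⟨
  toℚᵘ (ι m) ℚᵘ.+ toℚᵘ (ι n)           ≃⟨ toℚᵘ-homo-+ (ι m) (ι n) ⟨
  toℚᵘ (ι m + ι n)                     ∎)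
  where open ℚᵘ.≤-Reasoning

ι-* : ∀ m n → ι (m ℕ.* n) ≡ ι m * ι n
ι-* m n = toℚᵘ-injective (begin-equality
  toℚᵘ (ι (m ℕ.* n))                   ≃⟨ toℚᵘ-fromℚᵘ (ℚᵘ.mkℚᵘ (+ (m ℕ.* n)) 0) ⟩
  ℚᵘ.mkℚᵘ (+ (m ℕ.* n)) 0              ≃⟨ ℚᵘ.*≡* (cong (λ i → i ℤ.* + 1) (ℤ.pos-* m n)) ⟩
  ℚᵘ.mkℚᵘ (+ m) 0 ℚᵘ.* ℚᵘ.mkℚᵘ (+ n) 0 ≃⟨ ℚᵘ.*-cong (toℚᵘ-fromℚᵘ (ℚᵘ.mkℚᵘ (+ m) 0))
                                                     (toℚᵘ-fromℚᵘ (ℚᵘ.mkℚᵘ (+ n) 0)) ⟨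
  toℚᵘ (ι m) ℚᵘ.* toℚᵘ (ι n)           ≃⟨ toℚᵘ-homo-* (ι m) (ι n) ⟨
  toℚᵘ (ι m * ι n)                     ∎)
  where open ℚᵘ.≤-Reasoning

/-*-ι : ∀ i n .{{_ : ℕ.NonZero n}} → (i / n) * ι n ≡ i / 1
/-*-ι i n@(suc n-1) = toℚᵘ-injective (begin-equality
  toℚᵘ ((i / n) * ι n)                   ≃⟨ toℚᵘ-homo-* (i / n) (ι n) ⟩
  toℚᵘ (i / n) ℚᵘ.* toℚᵘ (ι n)           ≃⟨ ℚᵘ.*-cong (toℚᵘ-fromℚᵘ (ℚᵘ.mkℚᵘ i n-1))
                                                       (toℚᵘ-fromℚᵘ (ℚᵘ.mkℚᵘ (+ n) 0)) ⟩
  ℚᵘ.mkℚᵘ i n-1 ℚᵘ.* ℚᵘ.mkℚᵘ (+ n) 0     ≃⟨ ℚᵘ.*≡* (trans (ℤ.*-identityʳ (i ℤ.* + n))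
                                              (cong (λ m → i ℤ.* + m) (sym (ℕ.*-identityʳ n)))) ⟩
  ℚᵘ.mkℚᵘ i 0                            ≃⟨ toℚᵘ-fromℚᵘ (ℚᵘ.mkℚᵘ i 0) ⟨
  toℚᵘ (i / 1)                           ∎)
  where open ℚᵘ.≤-Reasoning

ι-pos : ∀ n .{{_ : ℕ.NonZero n}} → Positive (ι n)
ι-pos n = normalize-pos n 1

ι-nonNeg : ∀ n → NonNegative (ι n)
ι-nonNeg n = normalize-nonNeg n 1

1/-pos : ∀ n .{{_ : ℕ.NonZero n}} → Positive (+ 1 / n)
1/-pos n = normalize-pos 1 n

p≤p+nonNeg : ∀ p q .{{_ : NonNegative q}} → p ≤ p + q
p≤p+nonNeg p q = subst (_≤ p + q) (+-identityʳ p) (+-monoʳ-≤ p (nonNegative⁻¹ q))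

ι-mono-≤ : ∀ {m n} → m ℕ.≤ n → ι m ≤ ι n
ι-mono-≤ {m} {n} m≤n = begin
  ι m               ≤⟨ p≤p+nonNeg (ι m) (ι (n ℕ.∸ m)) {{ι-nonNeg (n ℕ.∸ m)}} ⟩
  ι m + ι (n ℕ.∸ m) ≡⟨ ι-+ m (n ℕ.∸ m) ⟨
  ι (m ℕ.+ (n ℕ.∸ m)) ≡⟨ cong ι (ℕ.m+[n∸m]≡n m≤n) ⟩
  ι n               ∎
  where open ≤-Reasoning

*-cancelʳ-≡-pos : ∀ {p q} r .{{_ : Positive r}} → p * r ≡ q * r → p ≡ q
*-cancelʳ-≡-pos r pr≡qr = ≤-antisym
  (*-cancelʳ-≤-pos r (≤-reflexive pr≡qr))
  (*-cancelʳ-≤-pos r (≤-reflexive (sym pr≡qr)))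

p+[q-p]≡q : ∀ p q → p + (q - p) ≡ q
p+[q-p]≡q = +-*-Solver.solve 2 (λ p q → (p :+ (q :- p)) := q) refl
  where open +-*-Solver

p<q⇒0<q-p : ∀ {p q} → p < q → 0ℚ < q - p
p<q⇒0<q-p {p} {q} p<q = subst (_< q - p) (+-inverseʳ p) (+-monoˡ-< (- p) p<q)

p-q≤r : ∀ {p q r} → p ≤ q + r → p - q ≤ r
p-q≤r {p} {q} {r} p≤q+r = begin
  p - q       ≤⟨ +-monoˡ-≤ (- q) p≤q+r ⟩
  q + r - q   ≡⟨ +-*-Solver.solve 2 (λ q r → ((q :+ r) :- q) := r) refl q r ⟩
  r           ∎
  where open ≤-Reasoning
        open +-*-Solver

archimedean : ∀ ε → 0ℚ < ε → ∃ λ d → ∀ n .{{_ : ℕ.NonZero n}} → d ℕ.< n → + 1 / n < ε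
archimedean ε 0<ε with positive 0<ε
-- The witness is the denominator of `ε`: for any larger `n`, the product of `ε` and `n` exceeds the
-- numerator, which is at least 1.
archimedean ε@(mkℚ (+ suc a) d-1 _) 0<ε | ε-pos = suc d-1 , λ n d<n →
  let instance
        ιn-nonNeg = ι-nonNeg n
  in *-cancelʳ-<-nonNeg (ι n) (begin-strict
  + 1 / n * ι n    ≡⟨ /-*-ι (+ 1) n ⟩
  ι 1              ≤⟨ ι-mono-≤ {1} {suc a} (ℕ.s≤s ℕ.z≤n) ⟩
  ι (suc a)        ≡⟨ /-*-ι (+ suc a) (suc d-1) ⟨
  (+ suc a / suc d-1) * ι (suc d-1) ≡⟨ cong (_* ι (suc d-1)) (↥p/↧p≡p ε) ⟩
  ε * ι (suc d-1)  <⟨ *-monoʳ-<-pos ε {{ε-pos}} (ι-mono-< d<n) ⟩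
  ε * ι n          ∎)
  where
  open ≤-Reasoning
  ι-mono-< : ∀ {m n} → m ℕ.< n → ι m < ι n
  ι-mono-< {m} {n} m<n = begin-strict
    ι m       ≡⟨ +-identityˡ (ι m) ⟨
    0ℚ + ι m  <⟨ +-monoˡ-< (ι m) (positive⁻¹ 1ℚ) ⟩
    1ℚ + ι m  ≡⟨ ι-+ 1 m ⟨
    ι (suc m) ≤⟨ ι-mono-≤ m<n ⟩
    ι n       ∎

-- Limits by trapping in small intervals

EventuallyIn : (ℕ → ℚ) → ℚ → ℚ → Set
EventuallyIn u a w = ∃ λ N → ∀ n → N ℕ.≤ n → a ≤ u n × u n ≤ a + w

∣p-q∣≤width : ∀ {p q a w} → a ≤ p × p ≤ a + w → a ≤ q × q ≤ a + w → ∣ p - q ∣ ≤ w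
∣p-q∣≤width {p} {q} {a} {w} (a≤p , p≤a+w) (a≤q , q≤a+w) with ∣p∣≡p∨∣p∣≡-p (p - q)
... | inj₁ eq = ≤-trans (≤-reflexive eq) (p-q≤r (≤-trans p≤a+w (+-monoˡ-≤ w a≤q)))
... | inj₂ eq = ≤-trans (≤-reflexive (trans eq (neg-sub p q)))
                        (p-q≤r (≤-trans q≤a+w (+-monoˡ-≤ w a≤p)))
  where
  neg-sub : ∀ p q → - (p - q) ≡ q - p
  neg-sub = +-*-Solver.solve 2 (λ p q → (:- (p :- q)) := (q :- p)) refl
    where open +-*-Solver

module Trapping (a w : ℕ → ℚ) (w→0 : ∀ ε → 0ℚ < ε → ∃ λ k → w k < ε) where

  Trapped : (ℕ → ℚ) → Set
  Trapped u = ∀ k → EventuallyIn u (a k) (w k)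

  trapped⇒cauchy : ∀ {u} → Trapped u → IsCauchy u
  trapped⇒cauchy u-in ε 0<ε =
    let k , w<ε = w→0 ε 0<ε
        N , h   = u-in k
    in N , λ m n N≤m N≤n → ≤-<-trans (∣p-q∣≤width (h m N≤m) (h n N≤n)) w<ε

  trapped⇒⟶ : ∀ {u v} → Trapped u → (v-in : Trapped v) → u ⟶ mkℝ v (trapped⇒cauchy v-in)
  trapped⇒⟶ {u} {v} u-in v-in ε 0<ε =
    let k , w<ε = w→0 ε 0<ε
        M , hu  = u-in k
        N , hv  = v-in k
    -- The slack `ε - w k` is the gap demanded by `_<ℝ_`; it depends on `k` alone, hence is uniform
    -- in `n`.
    in M , λ m M≤m → ε - w k , p<q⇒0<q-p w<ε , N , λ n N≤n → (let open ≤-Reasoning in begin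
      ∣ u m - v n ∣ + (ε - w k) ≤⟨ +-monoˡ-≤ (ε - w k) (∣p-q∣≤width (hu m M≤m) (hv n N≤n)) ⟩
      w k + (ε - w k)           ≡⟨ p+[q-p]≡q (w k) ε ⟩
      ε                         ∎)

-- Continuants

-- Euler's continuant of the first `n` entries. Expansion at the front matches `convergent`, which
-- also recurses into the shifted sequence.
continuant : (ℕ → ℕ) → ℕ → ℕ
continuant c 0             = 1
continuant c 1             = c 0
continuant c (suc (suc n)) =
  c 0 ℕ.* continuant (c ∘ suc) (suc n) ℕ.+ continuant (c ∘ suc ∘ suc) n

-- Expansion at the far end gives the usual three-term recurrence for numerators and denominators.
-- Both front continuants are expanded at their last entry and regrouped; the front recursion drops
-- up to two entries, hence two base cases.
continuant-last : ∀ c n → continuant c (suc (suc n)) ≡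
                          c (suc n) ℕ.* continuant c (suc n) ℕ.+ continuant c n
continuant-last c 0 = cong (ℕ._+ 1) (ℕ.*-comm (c 0) (c 1))
continuant-last c 1 = lemma (c 0) (c 1) (c 2)
  where
  lemma : ∀ a b d → a ℕ.* (b ℕ.* d ℕ.+ 1) ℕ.+ d ≡ d ℕ.* (a ℕ.* b ℕ.+ 1) ℕ.+ a
  lemma a b d = solve (a ∷ b ∷ d ∷ [])
continuant-last c (suc (suc n)) = trans
  (cong₂ (λ s t → c 0 ℕ.* s ℕ.+ t) (continuant-last (c ∘ suc) (suc n))
                                   (continuant-last (c ∘ suc ∘ suc) n))
  (lemma (c 0) (c (3 ℕ.+ n)) (continuant (c ∘ suc) (2 ℕ.+ n)) (continuant (c ∘ suc) (1 ℕ.+ n))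
         (continuant (c ∘ suc ∘ suc) (1 ℕ.+ n)) (continuant (c ∘ suc ∘ suc) n))
  where
  lemma : ∀ a b s t s′ t′ → a ℕ.* (b ℕ.* s ℕ.+ t) ℕ.+ (b ℕ.* s′ ℕ.+ t′) ≡
                            b ℕ.* (a ℕ.* s ℕ.+ s′) ℕ.+ (a ℕ.* t ℕ.+ t′)
  lemma a b s t s′ t′ = solve (a ∷ b ∷ s ∷ t ∷ s′ ∷ t′ ∷ [])

continuant-nonZero : ∀ c → (∀ n → ℕ.NonZero (c n)) → ∀ n → ℕ.NonZero (continuant c n)
continuant-nonZero c c≢0 0             = _
continuant-nonZero c c≢0 1             = c≢0 0
continuant-nonZero c c≢0 (suc (suc n)) = ℕ.>-nonZero (ℕ.<-≤-trans
  (ℕ.>-nonZero⁻¹ _ {{ℕ.m*n≢0 (c 0) _ {{c≢0 0}} {{continuant-nonZero (c ∘ suc) (c≢0 ∘ suc) (suc n)}}}})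
  (ℕ.m≤m+n _ _))

-- This is p / q with the denominator cleared. The tail's numerator `K′` is the new denominator, so
-- dividing it by the tail leaves the tail's denominator `K″`, and the front expansion assembles the
-- new numerator.
convergent-continuant : ∀ c c≢0 n →
  convergent c c≢0 n * ι (continuant (c ∘ suc) n) ≡ ι (continuant c (suc n))
convergent-continuant c c≢0 zero    = *-identityʳ (ι (c 0))
convergent-continuant c c≢0 (suc n) = begin
  (ι (c 0) + 1/t) * ι K′         ≡⟨ *-distribʳ-+ (ι K′) (ι (c 0)) 1/t ⟩
  ι (c 0) * ι K′ + 1/t * ι K′    ≡⟨ cong₂ _+_ (sym (ι-* (c 0) K′)) lemma ⟩
  ι (c 0 ℕ.* K′) + ι K″          ≡⟨ ι-+ (c 0 ℕ.* K′) K″ ⟨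
  ι (c 0 ℕ.* K′ ℕ.+ K″)          ∎
  where
  open ≡-Reasoning
  K′ = continuant (c ∘ suc) (suc n)
  K″ = continuant (c ∘ suc ∘ suc) n
  t  = convergent (c ∘ suc) (c≢0 ∘ suc) n
  instance
    t≢0 : NonZero t
    t≢0 = pos⇒nonZero t {{convergent-pos (c ∘ suc) (c≢0 ∘ suc) n}}
  1/t = 1/ t
  lemma : 1/t * ι K′ ≡ ι K″
  lemma = begin
    1/t * ι K′       ≡⟨ cong (1/t *_) (convergent-continuant (c ∘ suc) (c≢0 ∘ suc) n) ⟨
    1/t * (t * ι K″) ≡⟨ *-assoc 1/t t (ι K″) ⟨
    1/t * t * ι K″   ≡⟨ cong (_* ι K″) (*-inverseˡ t) ⟩
    1ℚ * ι K″        ≡⟨ *-identityˡ (ι K″) ⟩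
    ι K″             ∎

-- Indices by parity

double : ℕ → ℕ
double zero    = zero
double (suc n) = suc (suc (double n))

-- `double` recurses in step with `quotients`, two indices per shift of `x`, so every case holds by
-- computation.
quotients-1+double : ∀ x k → quotients x (suc (double k)) ≡ 1
quotients-1+double x zero    = refl
quotients-1+double x (suc k) = quotients-1+double (x ∘ suc) k

quotients-2+double : ∀ x k → quotients x (suc (suc (double k))) ≡ x (suc k)
quotients-2+double x zero    = refl
quotients-2+double x (suc k) = quotients-2+double (x ∘ suc) k

data Parity : ℕ → Set where
  even : ∀ k → Parity (double k)
  odd  : ∀ k → Parity (suc (double k))

parity : ∀ n → Parity n
parity zero    = even 0
parity (suc n) with parity n
... | even k = odd k
... | odd k  = even (suc k)

-- The extra `suc` lets one lemma serve even and odd upper indices alike.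
double-cancel-≤ : ∀ {j k} → double j ℕ.≤ suc (double k) → j ℕ.≤ k
double-cancel-≤ {zero}          _                    = ℕ.z≤n
double-cancel-≤ {suc j} {zero}  (ℕ.s≤s ())
double-cancel-≤ {suc j} {suc k} (ℕ.s≤s (ℕ.s≤s 2j≤2k+1)) = ℕ.s≤s (double-cancel-≤ 2j≤2k+1)

-- Comparing the convergents with the partial sums

module _ {x : ℕ → ℕ} (isX : IsSequenceX x) where
  open IsSequenceX isX

  private
    c : ℕ → ℕ
    c = quotients x

    c≢0 : ∀ n → ℕ.NonZero (c n)
    c≢0 = quotients-nonZero x x≢0

    p q : ℕ → ℕ
    p n = continuant c (suc n)
    q n = continuant (c ∘ suc) n

    C : ℕ → ℚ
    C = convergent c c≢0

    term : ℕ → ℚ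
    term i = (+ 1 / x (suc i)) {{x≢0 (suc i)}}

    S : ℕ → ℚ
    S = partialSum term

    q-nonZero : ∀ n → ℕ.NonZero (q n)
    q-nonZero = continuant-nonZero (c ∘ suc) (c≢0 ∘ suc)

    recurrence′ : ∀ n → x (2 ℕ.+ n) ℕ.* x n ≡ x (1 ℕ.+ n) ℕ.^ 2 ℕ.* (x n ℕ.+ 1)
    recurrence′ n = subst₂ (λ i j → x i ℕ.* x n ≡ x j ℕ.^ 2 ℕ.* (x n ℕ.+ 1))
                           (ℕ.+-comm n 2) (ℕ.+-comm n 1) (recurrence n)

    term-ι : ∀ k → term k * ι (x (suc k)) ≡ 1ℚ
    term-ι k = /-*-ι (+ 1) (x (suc k)) {{x≢0 (suc k)}}

    term-pos : ∀ k → Positive (term k)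
    term-pos k = 1/-pos (x (suc k)) {{x≢0 (suc k)}}

  -- Three-term recurrences and the joint induction

  q-2+double : ∀ k → q (double (suc k)) ≡ x (suc k) ℕ.* q (suc (double k)) ℕ.+ q (double k)
  q-2+double k = trans (continuant-last (c ∘ suc) (double k))
    (cong (λ a → a ℕ.* q (suc (double k)) ℕ.+ q (double k)) (quotients-2+double x k))

  q-3+double : ∀ k → q (suc (double (suc k))) ≡ q (double (suc k)) ℕ.+ q (suc (double k))
  q-3+double k = trans (continuant-last (c ∘ suc) (suc (double k)))
    (trans (cong (λ a → a ℕ.* q (double (suc k)) ℕ.+ q (suc (double k))) (quotients-1+double x (suc k)))
           (cong (ℕ._+ q (suc (double k))) (ℕ.*-identityˡ (q (double (suc k))))))

  p-2+double : ∀ k → p (double (suc k)) ≡ x (suc k) ℕ.* p (suc (double k)) ℕ.+ p (double k)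
  p-2+double k = trans (continuant-last c (suc (double k)))
    (cong (λ a → a ℕ.* p (suc (double k)) ℕ.+ p (double k)) (quotients-2+double x k))

  p-3+double : ∀ k → p (suc (double (suc k))) ≡ p (double (suc k)) ℕ.+ p (suc (double k))
  p-3+double k = trans (continuant-last c (suc (suc (double k))))
    (trans (cong (λ a → a ℕ.* p (double (suc k)) ℕ.+ p (suc (double k))) (quotients-1+double x (suc k)))
           (cong (ℕ._+ p (suc (double k))) (ℕ.*-identityˡ (p (double (suc k))))))

  -- `det` is the determinant identity of consecutive convergents, with q (2k) already replaced by x
  -- (k+1) and written without subtraction.
  record Invariant (k : ℕ) : Set where
    field
      q-even : q (double k) ≡ x (suc k)
      x-next : x (suc (suc k)) ≡ x (suc k) ℕ.* suc (q (suc (double k)))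
      det    : p (suc (double k)) ℕ.* x (suc k) ≡ p (double k) ℕ.* q (suc (double k)) ℕ.+ 1

  open Invariant

  -- `det` eliminates the odd numerator. The outcome is the recursion for the numerator of S (k+1)
  -- over x (k+1): passing to the next term multiplies the denominator by q (2k+1) + 1.
  p-even-next : ∀ k → Invariant k →
                p (double (suc k)) ≡ p (double k) ℕ.* suc (q (suc (double k))) ℕ.+ 1
  p-even-next k inv = begin
    p (double (suc k))      ≡⟨ p-2+double k ⟩
    x (suc k) ℕ.* P′ ℕ.+ P  ≡⟨ cong (ℕ._+ P) (ℕ.*-comm (x (suc k)) P′) ⟩
    P′ ℕ.* x (suc k) ℕ.+ P  ≡⟨ cong (ℕ._+ P) (det inv) ⟩
    P ℕ.* Q′ ℕ.+ 1 ℕ.+ P    ≡⟨ lemma P Q′ ⟩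
    P ℕ.* suc Q′ ℕ.+ 1      ∎
    where
    open ≡-Reasoning
    P  = p (double k)
    P′ = p (suc (double k))
    Q′ = q (suc (double k))
    lemma : ∀ a b → a ℕ.* b ℕ.+ 1 ℕ.+ a ≡ a ℕ.* suc b ℕ.+ 1
    lemma a b = solve (a ∷ b ∷ [])

  invariant : ∀ k → Invariant k
  -- Here p 0 = q 1 = 1 and p 1 = 2, so `x-next` asks for x 2 = 2 x 1. This is where the initial
  -- value x 0 = 1 enters.
  invariant zero = record { q-even = sym x₁≡1 ; x-next = x₂ ; det = cong (2 ℕ.*_) x₁≡1 }
    where
    open ≡-Reasoning
    x₂ : x 2 ≡ x 1 ℕ.* 2
    x₂ = begin
      x 2                          ≡⟨ ℕ.*-identityʳ (x 2) ⟨
      x 2 ℕ.* 1                    ≡⟨ cong (x 2 ℕ.*_) x₀≡1 ⟨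
      x 2 ℕ.* x 0                  ≡⟨ recurrence′ 0 ⟩
      x 1 ℕ.^ 2 ℕ.* (x 0 ℕ.+ 1)    ≡⟨ cong₂ (λ a b → a ℕ.^ 2 ℕ.* (b ℕ.+ 1)) x₁≡1 x₀≡1 ⟩
      1 ℕ.* 2                      ≡⟨ cong (ℕ._* 2) x₁≡1 ⟨
      x 1 ℕ.* 2                    ∎
  invariant (suc k) = record { q-even = q-even′ ; x-next = x-next′ ; det = det′ }
    where
    open ≡-Reasoning
    inv = invariant k
    X   = x (suc k)
    X⁺  = x (suc (suc k))
    P   = p (double k)
    P′  = p (suc (double k))
    P⁺  = p (double (suc k))
    Q′  = q (suc (double k))
    Q⁺′ = q (suc (double (suc k)))

    q-even′ : q (double (suc k)) ≡ X⁺
    q-even′ = begin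
      q (double (suc k))         ≡⟨ q-2+double k ⟩
      X ℕ.* Q′ ℕ.+ q (double k)  ≡⟨ cong (X ℕ.* Q′ ℕ.+_) (q-even inv) ⟩
      X ℕ.* Q′ ℕ.+ X             ≡⟨ ℕ.+-comm (X ℕ.* Q′) X ⟩
      X ℕ.+ X ℕ.* Q′             ≡⟨ ℕ.*-suc X Q′ ⟨
      X ℕ.* suc Q′               ≡⟨ x-next inv ⟨
      X⁺                         ∎

    q-odd′ : Q⁺′ ≡ X⁺ ℕ.+ Q′
    q-odd′ = trans (q-3+double k) (cong (ℕ._+ Q′) q-even′)

    x-next′ : x (suc (suc (suc k))) ≡ X⁺ ℕ.* suc Q⁺′
    -- In terms of ratios, the recurrence says that the next ratio is `X⁺` plus the old ratio `X⁺` /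
    -- `X`. The latter is `suc Q′`, and `X⁺ + Q′` is `Q⁺′`.
    x-next′ = ℕ.*-cancelʳ-≡ _ _ X {{x≢0 (suc k)}} (begin
      x (3 ℕ.+ k) ℕ.* X                      ≡⟨ recurrence′ (suc k) ⟩
      X⁺ ℕ.^ 2 ℕ.* (X ℕ.+ 1)                 ≡⟨ assoc X⁺ X ⟩
      X⁺ ℕ.* (X⁺ ℕ.* X ℕ.+ X⁺)               ≡⟨ cong (λ a → X⁺ ℕ.* (X⁺ ℕ.* X ℕ.+ a)) (x-next inv) ⟩
      X⁺ ℕ.* (X⁺ ℕ.* X ℕ.+ X ℕ.* suc Q′)     ≡⟨ factor X⁺ X Q′ ⟩
      X⁺ ℕ.* suc (X⁺ ℕ.+ Q′) ℕ.* X           ≡⟨ cong (λ a → X⁺ ℕ.* suc a ℕ.* X) q-odd′ ⟨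
      X⁺ ℕ.* suc Q⁺′ ℕ.* X                   ∎)
      where
      assoc : ∀ a b → a ℕ.* (a ℕ.* 1) ℕ.* (b ℕ.+ 1) ≡ a ℕ.* (a ℕ.* b ℕ.+ a)
      assoc a b = solve (a ∷ b ∷ [])
      factor : ∀ a b d → a ℕ.* (a ℕ.* b ℕ.+ b ℕ.* suc d) ≡ a ℕ.* suc (a ℕ.+ d) ℕ.* b
      factor a b d = solve (a ∷ b ∷ d ∷ [])

    det′ : p (suc (double (suc k))) ℕ.* X⁺ ≡ P⁺ ℕ.* Q⁺′ ℕ.+ 1
    -- The contribution `P⁺ * X⁺` is carried along; the point is that `P′ * X⁺` equals
    -- `P⁺ * Q′ + 1`, by the old determinant and `p-even-next`.
    det′ = begin
      p (suc (double (suc k))) ℕ.* X⁺             ≡⟨ cong (ℕ._* X⁺) (p-3+double k) ⟩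
      (P⁺ ℕ.+ P′) ℕ.* X⁺                          ≡⟨ ℕ.*-distribʳ-+ X⁺ P⁺ P′ ⟩
      P⁺ ℕ.* X⁺ ℕ.+ P′ ℕ.* X⁺                     ≡⟨ cong (λ a → P⁺ ℕ.* X⁺ ℕ.+ P′ ℕ.* a) (x-next inv) ⟩
      P⁺ ℕ.* X⁺ ℕ.+ P′ ℕ.* (X ℕ.* suc Q′)         ≡⟨ cong (P⁺ ℕ.* X⁺ ℕ.+_) (ℕ.*-assoc P′ X (suc Q′)) ⟨
      P⁺ ℕ.* X⁺ ℕ.+ P′ ℕ.* X ℕ.* suc Q′           ≡⟨ cong (λ a → P⁺ ℕ.* X⁺ ℕ.+ a ℕ.* suc Q′) (det inv) ⟩
      P⁺ ℕ.* X⁺ ℕ.+ (P ℕ.* Q′ ℕ.+ 1) ℕ.* suc Q′   ≡⟨ expand (P⁺ ℕ.* X⁺) P Q′ ⟩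
      P⁺ ℕ.* X⁺ ℕ.+ (P ℕ.* suc Q′ ℕ.+ 1) ℕ.* Q′ ℕ.+ 1
                                                  ≡⟨ cong (λ a → P⁺ ℕ.* X⁺ ℕ.+ a ℕ.* Q′ ℕ.+ 1) (p-even-next k inv) ⟨
      P⁺ ℕ.* X⁺ ℕ.+ P⁺ ℕ.* Q′ ℕ.+ 1               ≡⟨ cong (ℕ._+ 1) (ℕ.*-distribˡ-+ P⁺ X⁺ Q′) ⟨
      P⁺ ℕ.* (X⁺ ℕ.+ Q′) ℕ.+ 1                    ≡⟨ cong (λ a → P⁺ ℕ.* a ℕ.+ 1) q-odd′ ⟨
      P⁺ ℕ.* Q⁺′ ℕ.+ 1                            ∎
      where
      expand : ∀ a b d → a ℕ.+ (b ℕ.* d ℕ.+ 1) ℕ.* suc d ≡ a ℕ.+ (b ℕ.* suc d ℕ.+ 1) ℕ.* d ℕ.+ 1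
      expand a b d = solve (a ∷ b ∷ d ∷ [])

  -- Growth of the sequence and decay of the terms

  2≤1+q : ∀ n → 2 ℕ.≤ suc (q n)
  2≤1+q n = ℕ.s≤s (ℕ.>-nonZero⁻¹ (q n) {{q-nonZero n}})

  -- The ratio q (2k+1) + 1 is at least 2, so `x` doubles at each step. A linear bound is enough for
  -- the Archimedean argument.
  k<x[1+k] : ∀ k → k ℕ.< x (suc k)
  k<x[1+k] zero    = ℕ.≤-reflexive (sym x₁≡1)
  k<x[1+k] (suc k) = begin
    suc (suc k)                          ≤⟨ ℕ.s≤s (k<x[1+k] k) ⟩
    1 ℕ.+ x (suc k)                      ≤⟨ ℕ.+-monoˡ-≤ (x (suc k)) (ℕ.>-nonZero⁻¹ (x (suc k)) {{x≢0 (suc k)}}) ⟩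
    x (suc k) ℕ.+ x (suc k)              ≡⟨ twice (x (suc k)) ⟩
    x (suc k) ℕ.* 2                      ≤⟨ ℕ.*-monoʳ-≤ (x (suc k)) (2≤1+q (suc (double k))) ⟩
    x (suc k) ℕ.* suc (q (suc (double k))) ≡⟨ x-next (invariant k) ⟨
    x (suc (suc k))                      ∎
    where
    open ℕ.≤-Reasoning
    twice : ∀ a → a ℕ.+ a ≡ a ℕ.* 2
    twice a = solve (a ∷ [])

  term*ιx-next : ∀ k → term k * ι (x (suc (suc k))) ≡ ι (suc (q (suc (double k))))
  term*ιx-next k = begin
    term k * ι (x (suc (suc k)))    ≡⟨ cong (λ a → term k * ι a) (x-next (invariant k)) ⟩
    term k * ι (x (suc k) ℕ.* z)    ≡⟨ cong (term k *_) (ι-* (x (suc k)) z) ⟩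
    term k * (ι (x (suc k)) * ι z)  ≡⟨ *-assoc (term k) (ι (x (suc k))) (ι z) ⟨
    term k * ι (x (suc k)) * ι z    ≡⟨ cong (_* ι z) (term-ι k) ⟩
    1ℚ * ι z                        ≡⟨ *-identityˡ (ι z) ⟩
    ι z                             ∎
    where
    open ≡-Reasoning
    z = suc (q (suc (double k)))

  -- After multiplication by x (k+2) this compares 2 with the ratio q (2k+1) + 1. It keeps the upper
  -- ends of the intervals from increasing.
  term-halves : ∀ k → term (suc k) + term (suc k) ≤ term k
  term-halves k = *-cancelʳ-≤-pos (ι X⁺) {{ι-pos X⁺ {{x≢0 (suc (suc k))}}}} (begin
    (term (suc k) + term (suc k)) * ι X⁺        ≡⟨ *-distribʳ-+ (ι X⁺) (term (suc k)) (term (suc k)) ⟩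
    term (suc k) * ι X⁺ + term (suc k) * ι X⁺   ≡⟨ cong₂ _+_ (term-ι (suc k)) (term-ι (suc k)) ⟩
    ι 2                                         ≤⟨ ι-mono-≤ (2≤1+q (suc (double k))) ⟩
    ι (suc (q (suc (double k))))                ≡⟨ term*ιx-next k ⟨
    term k * ι X⁺                               ∎)
    where
    open ≤-Reasoning
    X⁺ = x (suc (suc k))

  -- Convergents in terms of partial sums

  S*ιx : ∀ k → S (suc k) * ι (x (suc k)) ≡ ι (p (double k))
  S*ιx zero    = trans (cong (_* ι (x 1)) (+-identityˡ (term 0))) (term-ι 0)
  S*ιx (suc k) = begin
    (S (suc k) + term (suc k)) * ι X⁺           ≡⟨ *-distribʳ-+ (ι X⁺) (S (suc k)) (term (suc k)) ⟩
    S (suc k) * ι X⁺ + term (suc k) * ι X⁺      ≡⟨ cong₂ _+_ (cong (λ a → S (suc k) * ι a) (x-next (invariant k)))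
                                                             (term-ι (suc k)) ⟩
    S (suc k) * ι (X ℕ.* z) + 1ℚ                ≡⟨ cong (λ a → S (suc k) * a + 1ℚ) (ι-* X z) ⟩
    S (suc k) * (ι X * ι z) + 1ℚ                ≡⟨ cong (_+ 1ℚ) (*-assoc (S (suc k)) (ι X) (ι z)) ⟨
    S (suc k) * ι X * ι z + 1ℚ                  ≡⟨ cong (λ a → a * ι z + 1ℚ) (S*ιx k) ⟩
    ι (p (double k)) * ι z + 1ℚ                 ≡⟨ cong (_+ 1ℚ) (ι-* (p (double k)) z) ⟨
    ι (p (double k) ℕ.* z) + ι 1                ≡⟨ ι-+ (p (double k) ℕ.* z) 1 ⟨
    ι (p (double k) ℕ.* z ℕ.+ 1)                ≡⟨ cong ι (p-even-next k (invariant k)) ⟨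
    ι (p (double (suc k)))                      ∎
    where
    open ≡-Reasoning
    X  = x (suc k)
    X⁺ = x (suc (suc k))
    z  = suc (q (suc (double k)))

  convergent-even : ∀ k → C (double k) ≡ S (suc k)
  convergent-even k = *-cancelʳ-≡-pos (ι X) {{ι-pos X {{x≢0 (suc k)}}}} (begin
    C (double k) * ι X               ≡⟨ cong (λ a → C (double k) * ι a) (q-even (invariant k)) ⟨
    C (double k) * ι (q (double k))  ≡⟨ convergent-continuant c c≢0 (double k) ⟩
    ι (p (double k))                 ≡⟨ S*ιx k ⟨
    S (suc k) * ι X                  ∎)
    where
    open ≡-Reasoning
    X = x (suc k)

  -- This is `det` divided by x (k+1): an odd convergent exceeds S (k+1) by `term k` over q (2k+1).
  convergent-odd : ∀ k → C (suc (double k)) * ι (q (suc (double k))) ≡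
                         S (suc k) * ι (q (suc (double k))) + term k
  convergent-odd k = *-cancelʳ-≡-pos (ι X) {{ι-pos X {{x≢0 (suc k)}}}} (begin
    C (suc (double k)) * ι Q′ * ι X             ≡⟨ cong (_* ι X) (convergent-continuant c c≢0 (suc (double k))) ⟩
    ι P′ * ι X                                  ≡⟨ ι-* P′ X ⟨
    ι (P′ ℕ.* X)                                ≡⟨ cong ι (det (invariant k)) ⟩
    ι (P ℕ.* Q′ ℕ.+ 1)                          ≡⟨ ι-+ (P ℕ.* Q′) 1 ⟩
    ι (P ℕ.* Q′) + 1ℚ                           ≡⟨ cong₂ _+_ (ι-* P Q′) (sym (term-ι k)) ⟩
    ι P * ι Q′ + term k * ι X                   ≡⟨ cong (λ a → a * ι Q′ + term k * ι X) (S*ιx k) ⟨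
    S (suc k) * ι X * ι Q′ + term k * ι X       ≡⟨ lemma (S (suc k)) (ι X) (ι Q′) (term k) ⟩
    (S (suc k) * ι Q′ + term k) * ι X           ∎)
    where
    open ≡-Reasoning
    X  = x (suc k)
    P  = p (double k)
    P′ = p (suc (double k))
    Q′ = q (suc (double k))
    lemma : ∀ a b d e → a * b * d + e * b ≡ (a * d + e) * b
    lemma = +-*-Solver.solve 4 (λ a b d e → (a :* b :* d :+ e :* b) := ((a :* d :+ e) :* b)) refl
      where open +-*-Solver

  -- The excess over S (k+1) is `term k` divided by a positive integer, so it lies between 0 and
  -- `term k`.
  C-odd-bounds : ∀ k → S (suc k) ≤ C (suc (double k)) × C (suc (double k)) ≤ S (suc k) + term k
  C-odd-bounds k =
    *-cancelʳ-≤-pos (ι Q′) (begin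
      s * ι Q′                  ≤⟨ p≤p+nonNeg (s * ι Q′) (term k) ⟩
      s * ι Q′ + term k         ≡⟨ convergent-odd k ⟨
      C (suc (double k)) * ι Q′ ∎) ,
    *-cancelʳ-≤-pos (ι Q′) (begin
      C (suc (double k)) * ι Q′ ≡⟨ convergent-odd k ⟩
      s * ι Q′ + term k         ≡⟨ cong (λ a → s * ι Q′ + a) (*-identityʳ (term k)) ⟨
      s * ι Q′ + term k * 1ℚ    ≤⟨ +-monoʳ-≤ (s * ι Q′) (*-monoˡ-≤-nonNeg (term k)
                                     (ι-mono-≤ (ℕ.>-nonZero⁻¹ Q′))) ⟩
      s * ι Q′ + term k * ι Q′  ≡⟨ *-distribʳ-+ (ι Q′) s (term k) ⟨
      (s + term k) * ι Q′       ∎)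
    where
    open ≤-Reasoning
    s  = S (suc k)
    Q′ = q (suc (double k))
    instance
      Q′≢0    = q-nonZero (suc (double k))
      Q′-pos  = ι-pos Q′
      term≥0  = pos⇒nonNeg (term k) {{term-pos k}}

  -- Nested intervals trapping both sequences

  intervals-nested : ∀ {k j} → k ℕ.≤′ j →
                     S (suc k) ≤ S (suc j) × S (suc j) + term j ≤ S (suc k) + term k
  intervals-nested (ℕ.≤′-reflexive refl) = ≤-refl , ≤-refl
  intervals-nested {k} {suc j} (ℕ.≤′-step k≤j) =
    let lower , upper = intervals-nested k≤j in
    ≤-trans lower (p≤p+nonNeg (S (suc j)) t {{pos⇒nonNeg t {{term-pos (suc j)}}}}) ,
    (begin
      -- The new term occurs twice, once in the sum and once as the width; by halving, both copies
      -- fit into the old width.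
      S (suc j) + t + t       ≡⟨ +-assoc (S (suc j)) t t ⟩
      S (suc j) + (t + t)     ≤⟨ +-monoʳ-≤ (S (suc j)) (term-halves j) ⟩
      S (suc j) + term j      ≤⟨ upper ⟩
      S (suc k) + term k      ∎)
    where
    open ≤-Reasoning
    t = term (suc j)

  term→0 : ∀ ε → 0ℚ < ε → ∃ λ k → term k < ε
  term→0 ε 0<ε =
    let d , h = archimedean ε 0<ε
    in d , h (x (suc d)) {{x≢0 (suc d)}} (k<x[1+k] d)

  -- The shift by one makes the interval of index k start at the convergent of index 2k.
  open Trapping (S ∘ suc) term term→0 public

  nested : ∀ {k j r} → k ℕ.≤ j → S (suc j) ≤ r × r ≤ S (suc j) + term j →
           S (suc k) ≤ r × r ≤ S (suc k) + term k
  nested k≤j (lower , upper) =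
    let lower′ , upper′ = intervals-nested (ℕ.≤⇒≤′ k≤j)
    in ≤-trans lower′ lower , ≤-trans upper upper′

  S-lower-end : ∀ j → S (suc j) ≤ S (suc j) × S (suc j) ≤ S (suc j) + term j
  S-lower-end j = ≤-refl , p≤p+nonNeg (S (suc j)) (term j) {{pos⇒nonNeg (term j) {{term-pos j}}}}

  S-trapped : Trapped S
  -- S (j+1) is the lower end of interval j, so interval k captures the partial sums from index k+1
  -- on.
  S-trapped k = suc k , λ { (suc j) (ℕ.s≤s k≤j) → nested k≤j (S-lower-end j) }

  C-trapped : Trapped C
  C-trapped k = double k , in-interval
    where
    in-interval : ∀ n → double k ℕ.≤ n → S (suc k) ≤ C n × C n ≤ S (suc k) + term k
    in-interval n 2k≤n with parity n
    ... | even j = nested (double-cancel-≤ (ℕ.m≤n⇒m≤1+n 2k≤n))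
                     (subst (λ r → S (suc j) ≤ r × r ≤ S (suc j) + term j)
                            (sym (convergent-even j)) (S-lower-end j))
    ... | odd j  = nested (double-cancel-≤ 2k≤n) (C-odd-bounds j)

mainTheorem6 : (x : ℕ → ℕ) → (isX : IsSequenceX x) →
    ∃ λ (α : ℝ) →
    HasCFValue (quotients x) (quotients-nonZero x (IsSequenceX.x≢0 isX)) α ×
    HasSum (λ i → (+ 1 / x (suc i)) {{IsSequenceX.x≢0 isX (suc i)}}) α
mainTheorem6 x isX =
  -- The partial sums themselves represent the limit; the convergents reach the same real because
  -- the same intervals trap them.
  mkℝ _ (trapped⇒cauchy isX (S-trapped isX)) ,
  trapped⇒⟶ isX (C-trapped isX) (S-trapped isX) ,
  trapped⇒⟶ isX (S-trapped isX) (S-trapped isX)
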